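{- For a positive integer $k$, let $p_k(n)$ denote the number of $k$-colored partitions of $n$, with generating function $$P_k(x)=\sum_{n\ge0}p_k(n)x^n=\prod_{m\ge1}(1-x^m)^{ -k}.$$ If $p$ is a prime, then $p_p(n)\equiv0\pmod p$ whenever $p\nmid n$.
   Context: A $k$-colored partition of $n$ is a partition of $n$ in which each part is assigned one of $k$ colors (order of parts being irrelevant). Here $p_p(n)$ means $p_k(n)$ with $k=p$. Series and products are formal power series. -}

module Defs where

open import Data.Fin.Base using (Fin; zero; suc)
import Data.Fin.Properties as Fin
open import Data.List.Base using (List; []; _∷_; _++_; [_]; map; length; lookup; upTo;
  allFin; cartesianProduct; cartesianProductWith; concatMap; deduplicate)
open import Data.List.Membership.Propositional using (_∈_)
open import Data.List.Membership.Propositional.Properties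
  using (∈-∃++; ∈-upTo⁺; ∈-allFin; ∈-cartesianProduct⁺; ∈-cartesianProductWith⁺; ∈-lookup)
import Data.List.Membership.DecPropositional as DecMembership
open import Data.List.Relation.Binary.Permutation.Propositional
  using (_↭_; ↭-refl; ↭-sym; ↭-trans; prep)
open import Data.List.Relation.Binary.Permutation.Propositional.Properties
  using (¬x∷xs↭[]; ∈-resp-↭; drop-∷; shift)
open import Data.List.Relation.Unary.All as All using (All; []; _∷_)
open import Data.List.Relation.Unary.AllPairs using ([]; _∷_)
open import Data.List.Relation.Unary.Any as Any using (Any; here; there; index)
open import Data.List.Relation.Unary.Any.Properties using (lookup-index; concatMap⁺)
open import Data.List.Relation.Unary.Enumerates.Setoid using (IsEnumeration)
open import Data.List.Relation.Unary.Enumerates.Setoid.Properties using (deduplicate⁺)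
open import Data.List.Relation.Unary.Unique.DecSetoid.Properties using (deduplicate-!)
import Data.List.Relation.Unary.Unique.Setoid as Uniqueₛ
open import Data.Nat.Base using (ℕ; zero; suc; _≤_; _<_; z≤n; s≤s)
open import Data.Nat.ListAction using (sum)
open import Data.Nat.Properties using (_≟_; _<?_; ≤-trans; ≤-reflexive; +-mono-≤; m≤m+n; m≤n+m)
open import Data.Product.Base using (_×_; _,_; proj₁)
open import Data.Product.Properties using (≡-dec)
open import Function.Bundles using (Inverse)
open import Level using (0ℓ)
open import Relation.Binary.Bundles using (Setoid; DecSetoid)
open import Relation.Binary.Definitions using (DecidableEquality; Decidable)
open import Relation.Binary.PropositionalEquality using (_≡_; refl; cong)
import Relation.Binary.PropositionalEquality.Properties as ≡
open import Relation.Nullary using (yes; no; contradiction)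
open import Relation.Nullary.Decidable using (map′)

record ColoredPartition (k n : ℕ) : Set where
  constructor mkColoredPartition
  field
    parts    : List (ℕ × Fin k)                      -- (size , color)
    positive : All (λ part → 0 < proj₁ part) parts
    total    : sum (map proj₁ parts) ≡ n

open ColoredPartition public

infix 4 _≈ᶜ_
_≈ᶜ_ : ∀ {k n} → ColoredPartition k n → ColoredPartition k n → Set
π ≈ᶜ ρ = parts π ↭ parts ρ

coloredPartitionSetoid : ℕ → ℕ → Setoid 0ℓ 0ℓ
coloredPartitionSetoid k n = record
  { Carrier       = ColoredPartition k n
  ; _≈_           = _≈ᶜ_
  ; isEquivalence = record { refl = ↭-refl ; sym = ↭-sym ; trans = ↭-trans }
  }

module _ {A : Set} (_≟ᴬ_ : DecidableEquality A) where
  open DecMembership _≟ᴬ_ using (_∈?_)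

  ↭-dec : Decidable (_↭_ {A = A})
  ↭-dec []       []       = yes ↭-refl
  ↭-dec []       (y ∷ ys) = no λ σ → ¬x∷xs↭[] (↭-sym σ)
  ↭-dec (x ∷ xs) ys with x ∈? ys
  ... | no x∉ys = no λ σ → x∉ys (∈-resp-↭ σ (here refl))
  ... | yes x∈ys with ∈-∃++ x∈ys
  ...   | as , bs , refl = map′
    (λ σ → ↭-trans (prep x σ) (↭-sym (shift x as bs)))
    (λ σ → drop-∷ (↭-trans σ (shift x as bs)))
    (↭-dec xs (as ++ bs))

coloredPartitionDecSetoid : ℕ → ℕ → DecSetoid 0ℓ 0ℓ
coloredPartitionDecSetoid k n = record
  { Carrier          = ColoredPartition k n
  ; _≈_              = _≈ᶜ_
  ; isDecEquivalence = record
    { isEquivalence = Setoid.isEquivalence (coloredPartitionSetoid k n)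
    ; _≟_           = λ π ρ → ↭-dec (≡-dec _≟_ Fin._≟_) (parts π) (parts ρ)
    }
  }

listsUpTo : {A : Set} → ℕ → List A → List (List A)
listsUpTo zero    as = [ [] ]
listsUpTo (suc ℓ) as = [] ∷ cartesianProductWith _∷_ as (listsUpTo ℓ as)

∈-listsUpTo : ∀ {A : Set} {as : List A} ℓ {xs} →
              length xs ≤ ℓ → All (_∈ as) xs → xs ∈ listsUpTo ℓ as
∈-listsUpTo zero    {[]}     _         []         = here refl
∈-listsUpTo (suc ℓ) {[]}     _         []         = here refl
∈-listsUpTo (suc ℓ) {x ∷ xs} (s≤s len) (x∈ ∷ xs∈) =
  there (∈-cartesianProductWith⁺ _∷_ x∈ (∈-listsUpTo ℓ len xs∈))

module _ {k n : ℕ} where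

  asColoredPartition : List (ℕ × Fin k) → List (ColoredPartition k n)
  asColoredPartition ps with All.all? (λ part → 0 <? proj₁ part) ps | sum (map proj₁ ps) ≟ n
  ... | yes pos | yes tot = [ mkColoredPartition ps pos tot ]
  ... | _       | _       = []

  ∈-asColoredPartition : (π : ColoredPartition k n) → Any (π ≈ᶜ_) (asColoredPartition (parts π))
  ∈-asColoredPartition π
    with All.all? (λ part → 0 <? proj₁ part) (parts π) | sum (map proj₁ (parts π)) ≟ n
  ... | yes _   | yes _   = here ↭-refl
  ... | no ¬pos | _       = contradiction (positive π) ¬pos
  ... | yes _   | no ¬tot = contradiction (total π) ¬tot

-- A partition of n has at most n parts, each of size at most n, so this list contains
-- every k-colored partition of n, in every ordering of its parts.
candidates : ∀ k n → List (ColoredPartition k n)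
candidates k n =
  concatMap asColoredPartition (listsUpTo n (cartesianProduct (upTo (suc n)) (allFin k)))

length≤sum : ∀ {k} {ps : List (ℕ × Fin k)} →
             All (λ part → 0 < proj₁ part) ps → length ps ≤ sum (map proj₁ ps)
length≤sum []          = z≤n
length≤sum (pos ∷ all) = +-mono-≤ pos (length≤sum all)

part≤sum : ∀ {k} (ps : List (ℕ × Fin k)) → All (λ part → proj₁ part ≤ sum (map proj₁ ps)) ps
part≤sum []             = []
part≤sum ((m , _) ∷ ps) =
  m≤m+n m _ ∷ All.map (λ le → ≤-trans le (m≤n+m _ m)) (part≤sum ps)

candidates-complete : ∀ k n → IsEnumeration (coloredPartitionSetoid k n) (candidates k n)
candidates-complete k n π = concatMap⁺ asColoredPartition
  (Any.map (λ { refl → ∈-asColoredPartition π })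
    (∈-listsUpTo n
      (≤-trans (length≤sum (positive π)) (≤-reflexive (total π)))
      (All.map
        (λ { {m , c} le →
             ∈-cartesianProduct⁺ (∈-upTo⁺ (s≤s (≤-trans le (≤-reflexive (total π))))) (∈-allFin c) })
        (part≤sum (parts π)))))

coloredPartitions : ∀ k n → List (ColoredPartition k n)
coloredPartitions k n =
  deduplicate (DecSetoid._≟_ (coloredPartitionDecSetoid k n)) (candidates k n)

numColoredPartitions : ℕ → ℕ → ℕ
numColoredPartitions k n = length (coloredPartitions k n)

module _ {S : Setoid 0ℓ 0ℓ} where
  open Setoid S using (_≈_) renaming (sym to ≈-sym; trans to ≈-trans)
  open Uniqueₛ S using (Unique)

  lookup-injective : ∀ {xs} → Unique xs → ∀ i j → lookup xs i ≈ lookup xs j → i ≡ j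
  lookup-injective (_  ∷ _)  zero    zero    _  = refl
  lookup-injective (x∉ ∷ _)  zero    (suc j) eq = contradiction eq (All.lookup x∉ (∈-lookup j))
  lookup-injective (x∉ ∷ _)  (suc i) zero    eq = contradiction (≈-sym eq) (All.lookup x∉ (∈-lookup i))
  lookup-injective (_  ∷ u)  (suc i) (suc j) eq = cong suc (lookup-injective u i j eq)

  enumeration⇒inverse : ∀ {xs} → IsEnumeration S xs → Unique xs →
                        Inverse S (≡.setoid (Fin (length xs)))
  enumeration⇒inverse {xs} enum uniq = record
    { to        = to
    ; from      = lookup xs
    ; to-cong   = to-cong
    ; from-cong = λ { refl → Setoid.refl S }
    ; inverse   = (λ {i} eq → lookup-injective uniq _ _ (≈-trans (≈-sym (lookup-index (enum _))) eq))
                , (λ { refl → ≈-sym (lookup-index (enum _)) })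
    }
    where
    to : Setoid.Carrier S → Fin (length xs)
    to x = index (enum x)

    to-cong : ∀ {x y} → x ≈ y → to x ≡ to y
    to-cong {x} {y} x≈y = lookup-injective uniq _ _
      (≈-trans (≈-sym (lookup-index (enum x))) (≈-trans x≈y (lookup-index (enum y))))

-- numColoredPartitions k n is the cardinality of the k-colored partitions of n,
-- taken up to the order of the parts.
numColoredPartitions-correct : ∀ k n →
  Inverse (coloredPartitionSetoid k n) (≡.setoid (Fin (numColoredPartitions k n)))
numColoredPartitions-correct k n = enumeration⇒inverse
  (deduplicate⁺ (coloredPartitionDecSetoid k n) (candidates-complete k n))
  (deduplicate-! (coloredPartitionDecSetoid k n) (candidates k n))

-- In every k-colored partition of n, the total sizes of the parts of the k colors add up to n.
-- Summing over all p_k(n) partitions, the contribution of each color is the same, since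
-- permuting the colors permutes the partitions.  Hence n p_k(n) is k times the contribution
-- of a single color, and for k = p prime with p ∤ n Euclid's lemma gives p ∣ p_p(n).
module Submission where

open import Defs using (numColoredPartitions)
open import Data.Nat using (ℕ)
open import Data.Nat.Divisibility using (_∣_; _∤_)
open import Data.Nat.Primality using (Prime)

open import Data.Bool.Base using (if_then_else_)
open import Data.Fin.Base using (Fin; zero; suc)
open import Data.Fin.Permutation
  using (Permutation; transpose; _⟨$⟩ʳ_; _⟨$⟩ˡ_; inverseˡ; inverseʳ)
import Data.Fin.Properties as Fin
open import Data.List.Base using (List; []; _∷_; map)
open import Data.List.Properties using (map-id; map-cong; map-∘)
open import Data.List.Relation.Binary.Permutation.Propositional
  using (_↭_; ↭-reflexive; ↭-trans)
open import Data.List.Relation.Binary.Permutation.Propositional.Properties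
  using () renaming (map⁺ to ↭-map⁺)
import Data.List.Relation.Unary.All.Properties as All
open import Data.Nat.Base using (zero; suc; _+_; _*_)
open import Data.Nat.Divisibility using (m∣m*n; _∣0; ∣-reflexive; ∣-trans)
open import Data.Nat.ListAction using (sum)
open import Data.Nat.ListAction.Properties using (sum-↭)
open import Data.Nat.Primality using (euclidsLemma)
open import Data.Nat.Properties using (+-0-commutativeMonoid; +-identityʳ)
open import Data.Product.Base using (_×_; _,_; proj₁; map₂)
open import Data.Sum.Base using ([_,_]′)
open import Function.Base using (id; _∘_)
open import Function.Bundles using (Inverse; mk⇔)
import Function.Construct.Composition as Compose
import Function.Construct.Symmetry as Symmetry
open import Relation.Binary.PropositionalEquality
  using (_≡_; _≗_; refl; sym; trans; cong; cong₂; module ≡-Reasoning)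
open import Relation.Nullary using (does; contradiction)
open import Relation.Nullary.Decidable using (dec-true; does-⇔)

open import Algebra.Properties.CommutativeMonoid.Sum +-0-commutativeMonoid
  using (sum-syntax; sum-cong-≗; sum-replicate-zero; ∑-distrib-+; ∑-comm; ∑-permute)
open import Defs using (ColoredPartition; mkColoredPartition; parts; positive; total;
  coloredPartitionSetoid; numColoredPartitions-correct)

open ≡-Reasoning

private
  variable
    k n : ℕ

∑-const : ∀ n x → ∑[ i < n ] x ≡ n * x
∑-const zero    x = refl
∑-const (suc n) x = cong (x +_) (∑-const n x)

-- Testing through `does` lets the comparison compute on constructors, so in the `suc` case the
-- leading zero term vanishes by reduction alone.
∑-indicator : ∀ (d : Fin k) m → ∑[ c < k ] (if does (c Fin.≟ d) then m else 0) ≡ m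
∑-indicator {suc k} zero    m = trans (cong (m +_) (sum-replicate-zero k)) (+-identityʳ m)
∑-indicator {suc k} (suc d) m = ∑-indicator d m

∣-∑-equal : (f : Fin k → ℕ) → (∀ c d → f c ≡ f d) → k ∣ ∑[ c < k ] f c
∣-∑-equal {zero}  f eq = 0 ∣0
∣-∑-equal {suc k} f eq = ∣-trans (m∣m*n (f zero))
  (∣-reflexive (sym (trans (sum-cong-≗ λ c → eq c zero) (∑-const (suc k) (f zero)))))

transpose-left : (i j : Fin n) → transpose i j ⟨$⟩ʳ i ≡ j
transpose-left i j rewrite dec-true (i Fin.≟ i) refl = refl

-- Parts of other colors are weighted by 0 instead of being filtered out, so that color totals are
-- plain sums over the same list and can be exchanged with sums over colors.
sizeInColor : Fin k → ℕ × Fin k → ℕ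
sizeInColor c (m , d) = if does (c Fin.≟ d) then m else 0

colorTotal : Fin k → List (ℕ × Fin k) → ℕ
colorTotal c = sum ∘ map (sizeInColor c)

-- Makes color totals well defined on partitions, which are identified up to reordering of parts.
colorTotal-↭ : ∀ (c : Fin k) {ps qs} → ps ↭ qs → colorTotal c ps ≡ colorTotal c qs
colorTotal-↭ c = sum-↭ ∘ ↭-map⁺ (sizeInColor c)

∑-colorTotal : (ps : List (ℕ × Fin k)) → ∑[ c < k ] colorTotal c ps ≡ sum (map proj₁ ps)
∑-colorTotal {k} []             = sum-replicate-zero k
∑-colorTotal {k} ((m , d) ∷ ps) = trans
  (∑-distrib-+ (λ c → sizeInColor c (m , d)) (λ c → colorTotal c ps))
  (cong₂ _+_ (∑-indicator d m) (∑-colorTotal ps))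

-- As `σ` is injective, applying it to both colors does not change the outcome of their comparison.
sizeInColor-permute : ∀ (σ : Permutation k k) c →
                      sizeInColor (σ ⟨$⟩ʳ c) ∘ map₂ (σ ⟨$⟩ʳ_) ≗ sizeInColor c
sizeInColor-permute σ c (m , d) = cong (if_then m else 0)
  (does-⇔ (mk⇔ injective (cong (σ ⟨$⟩ʳ_))) ((σ ⟨$⟩ʳ c) Fin.≟ (σ ⟨$⟩ʳ d)) (c Fin.≟ d))
  where
  injective : σ ⟨$⟩ʳ c ≡ σ ⟨$⟩ʳ d → c ≡ d
  injective eq = trans (sym (inverseˡ σ)) (trans (cong (σ ⟨$⟩ˡ_) eq) (inverseˡ σ))

colorTotal-permute : ∀ (σ : Permutation k k) c ps →
                     colorTotal (σ ⟨$⟩ʳ c) (map (map₂ (σ ⟨$⟩ʳ_)) ps) ≡ colorTotal c ps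
colorTotal-permute σ c ps =
  cong sum (trans (sym (map-∘ ps)) (map-cong (sizeInColor-permute σ c) ps))

recolor : (Fin k → Fin k) → ColoredPartition k n → ColoredPartition k n
recolor f π = mkColoredPartition (map (map₂ f) (parts π))
  (All.map⁺ (positive π))
  (trans (cong sum (sym (map-∘ (parts π)))) (total π))

-- Recoloring forth and back restores the list of parts exactly, so the inverse laws need only carry
-- along the given reordering.
recolor-inverse : Permutation k k →
                  Inverse (coloredPartitionSetoid k n) (coloredPartitionSetoid k n)
recolor-inverse σ = record
  { to        = recolor (σ ⟨$⟩ʳ_)
  ; from      = recolor (σ ⟨$⟩ˡ_)
  ; to-cong   = ↭-map⁺ _
  ; from-cong = ↭-map⁺ _
  ; inverse   = (λ {π} ρ↭ → ↭-trans (↭-map⁺ _ ρ↭)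
                  (↭-reflexive (cancel (λ _ → inverseʳ σ) (parts π))))
              , (λ {π} ρ↭ → ↭-trans (↭-map⁺ _ ρ↭)
                  (↭-reflexive (cancel (λ _ → inverseˡ σ) (parts π))))
  }
  where
  cancel : ∀ {f g : Fin _ → Fin _} → f ∘ g ≗ id →
           (ps : List (ℕ × Fin _)) → map (map₂ f) (map (map₂ g) ps) ≡ ps
  cancel f∘g≗id ps = trans (sym (map-∘ ps))
    (trans (map-cong (λ (m , c) → cong (m ,_) (f∘g≗id c)) ps) (map-id ps))

module _ (k n : ℕ) where

  private
    N = numColoredPartitions k n
    module Enum = Inverse (numColoredPartitions-correct k n)

    partsOf : Fin N → List (ℕ × Fin k)
    partsOf = parts ∘ Enum.from

  grandTotal : Fin k → ℕ
  grandTotal c = ∑[ i < N ] colorTotal c (partsOf i)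

  -- Recoloring by `σ` is a bijection on partitions; transported to indices it becomes `reindex`,
  -- along which the sum is rearranged.
  grandTotal-permute : ∀ (σ : Permutation k k) c → grandTotal (σ ⟨$⟩ʳ c) ≡ grandTotal c
  grandTotal-permute σ c = begin
    ∑[ i < N ] colorTotal (σ ⟨$⟩ʳ c) (partsOf i)
      ≡⟨ ∑-permute (λ i → colorTotal (σ ⟨$⟩ʳ c) (partsOf i)) reindex ⟩
    ∑[ i < N ] colorTotal (σ ⟨$⟩ʳ c) (partsOf (reindex ⟨$⟩ʳ i))
      -- The partition listed at the new index is only a reordering of the recolored one, which the
      -- color total does not see.
      ≡⟨ sum-cong-≗ {N} (λ i → colorTotal-↭ (σ ⟨$⟩ʳ c)
         (Enum.inverseʳ {recolor (σ ⟨$⟩ʳ_) (Enum.from i)} refl)) ⟩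
    ∑[ i < N ] colorTotal (σ ⟨$⟩ʳ c) (map (map₂ (σ ⟨$⟩ʳ_)) (partsOf i))
      ≡⟨ sum-cong-≗ (λ i → colorTotal-permute σ c (partsOf i)) ⟩
    ∑[ i < N ] colorTotal c (partsOf i) ∎
    where
    reindex : Permutation N N
    reindex = Compose.inverse (Symmetry.inverse (numColoredPartitions-correct k n))
      (Compose.inverse (recolor-inverse σ) (numColoredPartitions-correct k n))

  -- The transposition of `c` and `d` carries one color to the other.
  grandTotal-equal : ∀ c d → grandTotal c ≡ grandTotal d
  grandTotal-equal c d = trans (sym (grandTotal-permute (transpose c d) c))
    (cong grandTotal (transpose-left c d))

  -- Double counting: after exchanging the sums, each partition contributes its full size `n`.
  ∑-grandTotal : ∑[ c < k ] grandTotal c ≡ N * n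
  ∑-grandTotal = begin
    ∑[ c < k ] ∑[ i < N ] colorTotal c (partsOf i)
      ≡⟨ ∑-comm (λ c i → colorTotal c (partsOf i)) ⟩
    ∑[ i < N ] ∑[ c < k ] colorTotal c (partsOf i)
      ≡⟨ sum-cong-≗ (λ i → trans (∑-colorTotal (partsOf i)) (total (Enum.from i))) ⟩
    ∑[ i < N ] n
      ≡⟨ ∑-const N n ⟩
    N * n ∎

  k∣numColoredPartitions*n : k ∣ N * n
  k∣numColoredPartitions*n =
    ∣-trans (∣-∑-equal grandTotal grandTotal-equal) (∣-reflexive ∑-grandTotal)

corollary2p6 : (p : ℕ) → Prime p → (n : ℕ) → p ∤ n → p ∣ numColoredPartitions p n
corollary2p6 p prime-p n p∤n = [ id , (λ p∣n → contradiction p∣n p∤n) ]′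
  (euclidsLemma (numColoredPartitions p n) n prime-p (k∣numColoredPartitions*n p n))
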